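{- Let $\alpha$ be a reduced operation sequence. (a) Any operation of $\alpha$ whose corresponding operations do not occupy a set of consecutive positions of $\alpha$ is fixed. (b) Any operation of $\alpha$ that corresponds to a fixed operation of $\alpha$ is fixed.
   Context: Operation sequences: $\sigma[a]$ ($a\ge1$) denotes pushing the top $a$ elements of the input stack, as a block with relative order unchanged, onto the top of a working stack; $\tau[b]$ ($b\ge1$) denotes moving the top $b$ elements of the working stack, as a block with relative order unchanged, onto the top of an output stack; $\sigma=\sigma[1]$, $\tau=\tau[1]$. A well-formed operation sequence is a word $\alpha=\alpha_1\cdots\alpha_m$ in these symbols such that in every prefix the total push size is at least the total pop size, with equality for the whole word; its size $n$ is the total push size. Acting on an input stack containing $1,\dots,n$ with $1$ on top, it produces the permutation read from the final output stack top to bottom. Two well-formed sequences are equivalent if they have the same size and produce the same permutation. $\alpha$ is reduced if every consecutive pair $\alpha_i\alpha_{i+1}$ with $\alpha_i$ a push and $\alpha_{i+1}$ a pop equals $\sigma[1]\tau[1]$. The vertices of $\alpha$ are $v_0=(0,0)$ and $v_i=v_{i-1}+(a,a)$ if $\alpha_i=\sigma[a]$, $v_i=v_{i-1}+(b,-b)$ if $\alpha_i=\tau[b]$. The support of a push (resp. pop) is the set of elements it places on (resp. removes from) the working stack when $\alpha$ acts on input $1,\dots,n$. A push and a pop correspond if their supports intersect (the operations corresponding to a push are pops, and vice versa). An operation $\alpha_i$ of a reduced sequence $\alpha$ is fixed if for every reduced sequence $\beta=\beta_1\cdots\beta_{m'}$ equivalent to $\alpha$, with vertices $w_0,\dots,w_{m'}$,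 there is $j$ with $w_{j-1}=v_{i-1}$ and $w_j=v_i$. -}

module Defs where

open import Data.Empty using (⊥)
open import Data.Fin.Base using (Fin; toℕ; _<_)
open import Data.Integer.Base as ℤ using (ℤ; +_; 0ℤ)
open import Data.List.Base using (List; []; _++_; length; lookup; take; drop; foldl; map; sum; applyUpTo)
open import Data.List.Membership.Propositional using (_∈_)
open import Data.List.Relation.Unary.Linked using (Linked)
open import Data.Nat.Base using (ℕ; suc; _≤_; NonZero)
open import Data.Product.Base using (_×_; _,_; ∃-syntax; Σ-syntax)
open import Data.Sum.Base using (_⊎_)
open import Data.Unit.Base using (⊤)
open import Relation.Binary.PropositionalEquality using (_≡_)

data Op : Set where
  σ[_] : (a : ℕ) .{{_ : NonZero a}} → Op
  τ[_] : (b : ℕ) .{{_ : NonZero b}} → Op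

σ τ : Op
σ = σ[ 1 ]
τ = τ[ 1 ]

IsPush IsPop : Op → Set
IsPush σ[ _ ] = ⊤
IsPush τ[ _ ] = ⊥
IsPop σ[ _ ] = ⊥
IsPop τ[ _ ] = ⊤

pushSize popSize : Op → ℕ
pushSize σ[ a ] = a
pushSize τ[ _ ] = 0
popSize σ[ _ ] = 0
popSize τ[ b ] = b

totalPush totalPop : List Op → ℕ
totalPush α = sum (map pushSize α)
totalPop  α = sum (map popSize α)

size : List Op → ℕ
size = totalPush

record WellFormed (α : List Op) : Set where
  field
    prefixes : ∀ k → totalPop (take k α) ≤ totalPush (take k α)
    balanced : totalPop α ≡ totalPush α

-- The head of each list is the top of the corresponding stack.
record State : Set where
  constructor ⟨_,_,_⟩
  field
    input working output : List ℕ

open State public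

-- The truncation performed by take and drop on short stacks never occurs when a
-- well-formed sequence is run from its initial state.
step : State → Op → State
step ⟨ is , ws , os ⟩ σ[ a ] = ⟨ drop a is , take a is ++ ws , os ⟩
step ⟨ is , ws , os ⟩ τ[ b ] = ⟨ is , drop b ws , take b ws ++ os ⟩

-- 1, …, n with 1 on top.
initial : ℕ → State
initial n = ⟨ applyUpTo suc n , [] , [] ⟩

stateAfter : List Op → ℕ → State
stateAfter α k = foldl step (initial (size α)) (take k α)

permutation : List Op → List ℕ
permutation α = output (foldl step (initial (size α)) α)

record Equivalent (α β : List Op) : Set where
  field
    wellFormedˡ     : WellFormed α
    wellFormedʳ     : WellFormed β
    sameSize        : size α ≡ size β
    samePermutation : permutation α ≡ permutation β

record Reduced (α : List Op) : Set where
  field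
    wellFormed : WellFormed α
    pushPop    : Linked (λ x y → IsPush x → IsPop y → x ≡ σ × y ≡ τ) α

Point : Set
Point = ℤ × ℤ

advance : Point → Op → Point
advance (x , y) σ[ a ] = x ℤ.+ + a , y ℤ.+ + a
advance (x , y) τ[ b ] = x ℤ.+ + b , y ℤ.- + b

vertex : List Op → ℕ → Point
vertex α k = foldl advance (0ℤ , 0ℤ) (take k α)

-- Positions are counted from 0: position i holds the operation leading from
-- vertex α (toℕ i) to vertex α (suc (toℕ i)).
Position : List Op → Set
Position α = Fin (length α)

affected : Op → State → List ℕ
affected σ[ a ] s = take a (input s)
affected τ[ b ] s = take b (working s)

support : (α : List Op) → Position α → List ℕ
support α i = affected (lookup α i) (stateAfter α (toℕ i))

record Corresponds (α : List Op) (i j : Position α) : Set where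
  field
    opposite  : (IsPush (lookup α i) × IsPop (lookup α j))
              ⊎ (IsPop (lookup α i) × IsPush (lookup α j))
    intersect : ∃[ x ] (x ∈ support α i × x ∈ support α j)

Consecutive : ∀ {n} → (Fin n → Set) → Set
Consecutive P = ∀ {i j k} → i < j → j < k → P i → P k → P j

Fixed : (α : List Op) → Position α → Set
Fixed α i =
  ∀ β → Reduced β → Equivalent α β →
  Σ[ j ∈ Position β ] ( vertex β (toℕ j)       ≡ vertex α (toℕ i)
                      × vertex β (suc (toℕ j)) ≡ vertex α (suc (toℕ i)) )

{-# OPTIONS --safe #-}
-- Index the elements by their value x and their rank r in the output.  For x < y whose
-- stays on the working stack overlap, y comes out before x exactly when "x and y share a
-- push" and "x and y share a pop" have the same truth value; so for two equivalent
-- sequences in which the answers to one of these questions agree, the answers to the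
-- other agree too.  In a reduced sequence the last element pushed before x is popped
-- leaves alone, immediately after its push; hence y is pushed before x is popped iff some
-- z ≥ y has rank at most that of x, which depends on the permutation only.
--
-- (a) If x and y share a push but their pops are separated by a push of w, then every u has
-- its pop separated by w from that of x or that of y, in all equivalent reduced sequences,
-- so whether u shares the push of x and y is determined.  (b) If a pop is fixed, then
-- sharing that pop is determined, hence so is sharing any push that meets it.
module Submission where

open import Defs
open import Data.Fin.Base using (Fin; zero; suc; toℕ)
import Data.Fin.Properties as Fin
open import Data.Integer.Base as ℤ using () renaming (+_ to pos)
import Data.Integer.Properties as ℤ
open import Data.Integer.Tactic.RingSolver using (solve-∀)
open import Data.List.Base using (List; []; _∷_; _++_; length; take; drop; foldl; map; lookup; applyUpTo)
open import Data.List.Membership.Propositional using (_∈_)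
open import Data.List.Membership.Propositional.Properties using (∈-++⁻)
open import Data.List.Properties
  using (length-++; ++-assoc; ++-identityʳ; take++drop≡id; length-take; length-drop; foldl-++; take-all)
open import Data.List.Relation.Binary.Permutation.Propositional using (_↭_; ↭-trans; ↭-reflexive; ↭-sym; ↭⇒↭ₛ)
open import Data.List.Relation.Binary.Permutation.Propositional.Properties using (∈-resp-↭; ++⁺ˡ; shifts)
import Data.List.Relation.Binary.Permutation.Setoid.Properties as Permutationₛ
open import Data.List.Relation.Unary.All as All using (All; []; _∷_)
import Data.List.Relation.Unary.All.Properties as All
open import Data.List.Relation.Unary.AllPairs using (AllPairs; []; _∷_)
import Data.List.Relation.Unary.AllPairs.Properties as AllPairs
open import Data.List.Relation.Unary.Any using (here; there)
open import Data.List.Relation.Unary.Linked using (Linked; _∷_)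
open import Data.List.Relation.Unary.Unique.Propositional using (Unique)
open import Data.Nat.Base using (ℕ; zero; suc; z≤n; s≤s; z<s; _+_; _∸_; _≤_; _<_; NonZero; >-nonZero⁻¹)
open import Data.Nat.ListAction using (sum)
open import Data.Nat.Properties
open import Data.Product.Base using (_×_; _,_; proj₁; proj₂; ∃-syntax; Σ-syntax)
import Data.Product.Properties as Product
open import Data.Sum.Base using (_⊎_; inj₁; inj₂)
open import Function.Base using (_∘_; id)
open import Function.Bundles using (_⇔_; mk⇔; Equivalence)
open import Function.Construct.Symmetry using (⇔-sym)
open import Relation.Binary.Definitions using (tri<; tri≈; tri>)
open import Relation.Binary.PropositionalEquality
open import Relation.Nullary.Decidable using (Dec; yes; no; _×-dec_; decidable-stable)
open import Relation.Nullary.Negation.Core using (¬_; contradiction)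

open Equivalence using (to; from)

-- Abstract schedules of pushes and pops.

-- The order of two elements on the working stack, e being nearer to the top.
Above : {E : Set} (el push : E → ℕ) → E → E → Set
Above el push e f = push f < push e ⊎ (push e ≡ push f × el e < el f)

-- Elements are tagged with their value el and their rank rk in the output,
-- counted from the bottom; push and pop are positions in the operation sequence.
record Schedule {E : Set} (el rk : E → ℕ) : Set where
  field
    push pop  : E → ℕ
    push<pop  : ∀ e → push e < pop e
    push≢pop  : ∀ e f → push e ≢ pop f
    push-mono : ∀ e f → el e ≤ el f → push e ≤ push f
    pop-mono  : ∀ e f → rk e ≤ rk f → pop e ≤ pop f
    -- The stack rule. If `f` leaves in an earlier pop while `e` is present, `f` is above `e`; if
    -- both leave in one block, which keeps its order, the one of higher rank is above.
    law       : ∀ e f → rk f < rk e →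
                (pop f < pop e × (push e < pop f → Above el push f e)) ⊎
                (pop e ≡ pop f × Above el push e f)
    -- The form in which reducedness enters: the order of a push and a pop reduces to a statement
    -- about values and ranks.
    peak      : ∀ e f → push f < pop e → ∃[ g ] (el f ≤ el g × rk g ≤ rk e)

  push-cong : ∀ {e f} → el e ≡ el f → push e ≡ push f
  push-cong {e} {f} p = ≤-antisym (push-mono e f (≤-reflexive p)) (push-mono f e (≤-reflexive (sym p)))

  pop-cong : ∀ {e f} → rk e ≡ rk f → pop e ≡ pop f
  pop-cong {e} {f} p = ≤-antisym (pop-mono e f (≤-reflexive p)) (pop-mono f e (≤-reflexive (sym p)))

  push<⇒el< : ∀ {e f} → push e < push f → el e < el f
  push<⇒el< {e} {f} p = ≰⇒> λ q → <⇒≱ p (push-mono f e q)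

  pop<⇒rk< : ∀ {e f} → pop e < pop f → rk e < rk f
  pop<⇒rk< {e} {f} p = ≰⇒> λ q → <⇒≱ p (pop-mono f e q)

  push≮pop⇒pop<push : ∀ {e f} → ¬ (push e < pop f) → pop f < push e
  push≮pop⇒pop<push {e} {f} p = ≤∧≢⇒< (≮⇒≥ p) (push≢pop e f ∘ sym)

  pop<⇒above : ∀ {e f} → pop f < pop e → push e < pop f → Above el push f e
  pop<⇒above {e} {f} p q with law e f (pop<⇒rk< p)
  ... | inj₁ (_ , above) = above q
  ... | inj₂ (eq , _)    = contradiction (sym eq) (<⇒≢ p)

  above⇒push≤ : ∀ {e f} → Above el push e f → push f ≤ push e
  above⇒push≤ (inj₁ p)       = <⇒≤ p
  above⇒push≤ (inj₂ (p , _)) = ≤-reflexive (sym p)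

  -- Finds a push in the gap between the two pops. If `k` pops `w` instead, then `w` was pushed in
  -- the gap too: lying under `x` and `y` it could not leave ahead of `y`, and lying above `x` it
  -- could not outlast `x`.
  push-separates : ∀ {x y w k} → push x ≡ push y → pop x < k → k < pop y →
                   push w ≡ k ⊎ (pop w ≡ k × push w ≢ push x) →
                   pop x < push w × push w < pop y
  push-separates _ x<k k<y (inj₁ refl) = x<k , k<y
  push-separates {x} {y} {w} eq x<w w<y (inj₂ (refl , w≢x))
    with <-cmp (push w) (push x)
  ... | tri≈ _ w≡x _ = contradiction w≡x w≢x
  ... | tri< w<x _ _ = contradiction w<x (≤⇒≯ (subst (_≤ push w) (sym eq)
          (above⇒push≤ (pop<⇒above w<y (subst (_< pop w) eq (<-trans (push<pop x) x<w))))))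
  ... | tri> _ _ x<w′ = push≮pop⇒pop<push (λ p → <⇒≱ x<w′ (above⇒push≤ (pop<⇒above x<w p)))
                      , <-trans (push<pop w) w<y

  -- The dual: finds a pop between the two pushes. An element `w` pushed after `x` and before `y` is
  -- caught between them on the stack, so unless it leaves together with them it must be gone before
  -- `y` arrives.
  pop-separates : ∀ {x y w k} → pop x ≡ pop y → push x < k → k < push y →
                  pop w ≡ k ⊎ (push w ≡ k × pop w ≢ pop x) →
                  push x < pop w × pop w < push y
  pop-separates _ x<k k<y (inj₁ refl) = x<k , k<y
  pop-separates {x} {y} {w} eq x<w w<y (inj₂ (refl , w≢x)) =
    <-trans x<w (push<pop w) , push≮pop⇒pop<push nested
    where
    nested : ¬ (push y < pop w)
    nested y<w with <-cmp (pop w) (pop x)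
    ... | tri≈ _ w≡x _ = w≢x w≡x
    ... | tri< w<x _ _ = <⇒≱ w<y (above⇒push≤ (pop<⇒above (subst (pop w <_) eq w<x) y<w))
    ... | tri> _ _ x<w′ = <⇒≱ x<w (above⇒push≤ (pop<⇒above x<w′
            (<-trans w<y (subst (push y <_) (sym eq) (push<pop y)))))

open Schedule

-- Comparison of two schedules of the same elements.

module _ {E : Set} {el rk : E → ℕ} where

  -- The witness `g` of `peak` is characterised by values and ranks only, so in `T` as well its push
  -- and pop, in this order, lie weakly between the push of `f` and the pop of `e`.
  push<pop-invariant : (S T : Schedule el rk) → ∀ {e f} → push S f < pop S e → push T f < pop T e
  push<pop-invariant S T {e} {f} p with g , f≤g , g≤e ← peak S e f p =
    ≤-<-trans (push-mono T f g f≤g) (<-≤-trans (push<pop T g) (pop-mono T g e g≤e))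

  pop<push-invariant : (S T : Schedule el rk) → ∀ {e f} → pop S e < push S f → pop T e < push T f
  pop<push-invariant S T p = push≮pop⇒pop<push T λ q → <-asym p (push<pop-invariant T S q)

  -- Vertex i of one sequence is vertex j of the other.
  record Cut (S T : Schedule el rk) (i j : ℕ) : Set where
    constructor cut
    field
      pushes : ∀ u → push S u < i ⇔ push T u < j
      pops   : ∀ u → pop S u < i ⇔ pop T u < j

  open Cut public

  -- A common step of the two lattice paths, once cuts are identified with common vertices.
  Edge : (S T : Schedule el rk) → ℕ → ℕ → Set
  Edge S T i j = Cut S T i j × Cut S T (suc i) (suc j)

  -- Fixedness of the push or pop of `e`, expressed by the set of elements moved with `e` and free
  -- of coordinates.
  PushBlock PopBlock : (S T : Schedule el rk) → E → Set
  PushBlock S T e = ∀ u → push S u ≡ push S e ⇔ push T u ≡ push T e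
  PopBlock  S T e = ∀ u → pop S u ≡ pop S e ⇔ pop T u ≡ pop T e

  module _ (S T : Schedule el rk) {e : E} where

    push-mono-< : PushBlock S T e → ∀ {u} → push S u < push S e → push T u < push T e
    push-mono-< same {u} p =
      ≤∧≢⇒< (push-mono T u e (<⇒≤ (push<⇒el< S p))) λ q → <⇒≢ p (from (same u) q)

    push-mono-<suc : PushBlock S T e → ∀ {u} → push S u < suc (push S e) → push T u < suc (push T e)
    push-mono-<suc same {u} (s≤s p) with m≤n⇒m<n∨m≡n p
    ... | inj₁ lt = m≤n⇒m≤1+n (push-mono-< same lt)
    ... | inj₂ eq = s≤s (≤-reflexive (to (same u) eq))

    pop-mono-< : PopBlock S T e → ∀ {u} → pop S u < pop S e → pop T u < pop T e
    pop-mono-< same {u} p =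
      ≤∧≢⇒< (pop-mono T u e (<⇒≤ (pop<⇒rk< S p))) λ q → <⇒≢ p (from (same u) q)

    pop-mono-<suc : PopBlock S T e → ∀ {u} → pop S u < suc (pop S e) → pop T u < suc (pop T e)
    pop-mono-<suc same {u} (s≤s p) with m≤n⇒m<n∨m≡n p
    ... | inj₁ lt = m≤n⇒m≤1+n (pop-mono-< same lt)
    ... | inj₂ eq = s≤s (≤-reflexive (to (same u) eq))

    -- No pop occupies the position of a push, so the bound `suc (push S e)` is as good as the
    -- strict bound `push S e`.
    pop<suc-push : ∀ {u} → pop S u < suc (push S e) → pop T u < suc (push T e)
    pop<suc-push {u} (s≤s p) =
      m≤n⇒m≤1+n (pop<push-invariant S T (≤∧≢⇒< p (push≢pop S e u ∘ sym)))

    push<suc-pop : ∀ {u} → push S u < suc (pop S e) → push T u < suc (pop T e)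
    push<suc-pop {u} (s≤s p) =
      m≤n⇒m≤1+n (push<pop-invariant S T (≤∧≢⇒< p (push≢pop S u e)))

  module _ {S T : Schedule el rk} {e : E} where

    -- For pushes, monotonicity in `el` and agreement on the block locate both cuts; for pops, the
    -- order of a pop and a push is the same in both schedules.
    pushBlock⇒edge : PushBlock S T e → Edge S T (push S e) (push T e)
    pushBlock⇒edge same =
        cut (λ _ → mk⇔ (push-mono-< S T same) (push-mono-< T S same⁻¹))
            (λ _ → mk⇔ (pop<push-invariant S T) (pop<push-invariant T S))
      , cut (λ _ → mk⇔ (push-mono-<suc S T same) (push-mono-<suc T S same⁻¹))
            (λ _ → mk⇔ (pop<suc-push S T) (pop<suc-push T S))
      where same⁻¹ = λ u → ⇔-sym (same u)

    popBlock⇒edge : PopBlock S T e → Edge S T (pop S e) (pop T e)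
    popBlock⇒edge same =
        cut (λ _ → mk⇔ (push<pop-invariant S T) (push<pop-invariant T S))
            (λ _ → mk⇔ (pop-mono-< S T same) (pop-mono-< T S same⁻¹))
      , cut (λ _ → mk⇔ (push<suc-pop S T) (push<suc-pop T S))
            (λ _ → mk⇔ (pop-mono-<suc S T same) (pop-mono-<suc T S same⁻¹))
      where same⁻¹ = λ u → ⇔-sym (same u)

    private
      -- Equality with `i` means lying below `suc i` but not below `i`, and both conditions
      -- transfer.
      suc-cut : ∀ {m m′ i j} → (m < i ⇔ m′ < j) → (m < suc i ⇔ m′ < suc j) → m ≡ i → m′ ≡ j
      suc-cut p q refl = ≤-antisym (≤-pred (to q ≤-refl)) (≮⇒≥ λ r → <-irrefl refl (from p r))

    edge⇒pushBlock : ∀ {j} → Edge S T (push S e) j → PushBlock S T e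
    edge⇒pushBlock (c , d) u
      -- Applied to `e` itself, the two cuts force `j` to be `push T e`.
      with refl ← suc-cut (pushes c e) (pushes d e) refl
      = mk⇔ (suc-cut (pushes c u) (pushes d u))
            (suc-cut (⇔-sym (pushes c u)) (⇔-sym (pushes d u)))

    edge⇒popBlock : ∀ {j} → Edge S T (pop S e) j → PopBlock S T e
    edge⇒popBlock (c , d) u
      with refl ← suc-cut (pops c e) (pops d e) refl
      = mk⇔ (suc-cut (pops c u) (pops d u))
            (suc-cut (⇔-sym (pops c u)) (⇔-sym (pops d u)))

  -- Transfer between shared pushes and shared pops.

  module _ (rk-determines-el : ∀ e f → rk e ≡ rk f → el e ≡ el f) where

    private
      -- Agreement on the pops makes `law` put the same element on top in both schedules. The upper
      -- element has the smaller value if the push is shared and the larger value otherwise, so the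
      -- order of the values decides.
      samePush< : (S T : Schedule el rk) → ∀ {e f} → rk f < rk e →
                  (pop S e ≡ pop S f ⇔ pop T e ≡ pop T f) →
                  push S e ≡ push S f → push T e ≡ push T f
      samePush< S T {e} {f} lt samePop eq with law S e f lt | law T e f lt
      ... | inj₁ (p , _)  | inj₂ (q , _)  = contradiction (sym (from samePop q)) (<⇒≢ p)
      ... | inj₂ (p , _)  | inj₁ (q , _)  = contradiction (sym (to samePop p)) (<⇒≢ q)
      ... | inj₁ (_ , aS) | inj₁ (_ , aT)
          -- The shared push precedes the pop of `f`, so `e` is already pushed when `f` leaves, in
          -- `S` and by invariance in `T`.
          with e<f ← subst (_< pop S f) (sym eq) (push<pop S f)
          with aS e<f | aT (push<pop-invariant S T e<f)
      ... | inj₁ p | _             = contradiction eq (<⇒≢ p)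
      ... | inj₂ _ | inj₂ (q , _)  = sym q
      ... | inj₂ (_ , f<e) | inj₁ q = contradiction (push<⇒el< T q) (<-asym f<e)
      samePush< S T {e} {f} lt samePop eq | inj₂ (_ , aS) | inj₂ (_ , aT) with aS | aT
      ... | inj₁ p | _             = contradiction (sym eq) (<⇒≢ p)
      ... | inj₂ _ | inj₂ (q , _)  = q
      ... | inj₂ (_ , e<f) | inj₁ q = contradiction (push<⇒el< T q) (<-asym e<f)

      -- In `S` the element `e` lies above `f`. If `f` left strictly first in `T`, it would lie
      -- above `e` there; with agreement on whether the push is shared, the two values would be
      -- ordered both ways.
      samePop< : (S T : Schedule el rk) → ∀ {e f} → rk f < rk e →
                 (push S e ≡ push S f ⇔ push T e ≡ push T f) →
                 pop S e ≡ pop S f → pop T e ≡ pop T f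
      samePop< S T {e} {f} lt samePush eq with law S e f lt | law T e f lt
      ... | inj₁ (p , _)  | _            = contradiction (sym eq) (<⇒≢ p)
      ... | inj₂ _        | inj₂ (q , _) = q
      ... | inj₂ (_ , aS) | inj₁ (_ , aT)
          with aS | aT (push<pop-invariant S T (subst (push S e <_) eq (push<pop S e)))
      ... | inj₁ p         | inj₁ q         = contradiction (push<⇒el< T q) (<-asym (push<⇒el< S p))
      ... | inj₁ p         | inj₂ (q , _)   = contradiction (sym (from samePush (sym q))) (<⇒≢ p)
      ... | inj₂ (p , _)   | inj₁ q         = contradiction (to samePush p) (<⇒≢ q)
      ... | inj₂ (_ , e<f) | inj₂ (_ , f<e) = contradiction f<e (<-asym e<f)

      sym⇔ : ∀ {a b c d : ℕ} → (a ≡ b ⇔ c ≡ d) → (b ≡ a ⇔ d ≡ c)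
      sym⇔ p = mk⇔ (sym ∘ to p ∘ sym) (sym ∘ from p ∘ sym)

      samePush : (S T : Schedule el rk) → ∀ {e f} →
                 (pop S e ≡ pop S f ⇔ pop T e ≡ pop T f) →
                 push S e ≡ push S f → push T e ≡ push T f
      samePush S T {e} {f} same eq with <-cmp (rk f) (rk e)
      ... | tri< lt _ _ = samePush< S T lt same eq
      ... | tri≈ _ r _  = push-cong T (sym (rk-determines-el f e r))
      ... | tri> _ _ gt = sym (samePush< S T gt (sym⇔ same) (sym eq))

      samePop : (S T : Schedule el rk) → ∀ {e f} →
                (push S e ≡ push S f ⇔ push T e ≡ push T f) →
                pop S e ≡ pop S f → pop T e ≡ pop T f
      samePop S T {e} {f} same eq with <-cmp (rk f) (rk e)
      ... | tri< lt _ _ = samePop< S T lt same eq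
      ... | tri≈ _ r _  = pop-cong T (sym r)
      ... | tri> _ _ gt = sym (samePop< S T gt (sym⇔ same) (sym eq))

    module _ (S T : Schedule el rk) where

      samePop⇒samePush : ∀ {e f} → (pop S e ≡ pop S f ⇔ pop T e ≡ pop T f) →
                         push S e ≡ push S f ⇔ push T e ≡ push T f
      samePop⇒samePush same = mk⇔ (samePush S T same) (samePush T S (⇔-sym same))

      samePush⇒samePop : ∀ {e f} → (push S e ≡ push S f ⇔ push T e ≡ push T f) →
                         pop S e ≡ pop S f ⇔ pop T e ≡ pop T f
      samePush⇒samePop same = mk⇔ (samePop S T same) (samePop T S (⇔-sym same))

      popBlock⇒pushBlock : ∀ {e} → PopBlock S T e → PushBlock S T e
      popBlock⇒pushBlock same u = samePop⇒samePush (same u)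

      pushBlock⇒popBlock : ∀ {e} → PushBlock S T e → PopBlock S T e
      pushBlock⇒popBlock same u = samePush⇒samePop (same u)

      -- The push of `w` keeps the two pops apart in both schedules, as its order relative to each
      -- is invariant. The pops are thus shared in neither, and the transfer applies.
      separated⇒samePush : ∀ {e f w} → pop S e < push S w → push S w < pop S f →
                           push S e ≡ push S f ⇔ push T e ≡ push T f
      separated⇒samePush p q = samePop⇒samePush (mk⇔
        (λ eq → contradiction eq (<⇒≢ (<-trans p q)))
        (λ eq → contradiction eq (<⇒≢ (<-trans (pop<push-invariant S T p) (push<pop-invariant S T q)))))

      separated⇒samePop : ∀ {e f w} → push S e < pop S w → pop S w < push S f →
                          pop S e ≡ pop S f ⇔ pop T e ≡ pop T f
      separated⇒samePop p q = samePush⇒samePop (mk⇔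
        (λ eq → contradiction eq (<⇒≢ (<-trans p q)))
        (λ eq → contradiction eq (<⇒≢ (<-trans (push<pop-invariant S T p) (pop<push-invariant S T q)))))

      -- Every element is popped before or after w is pushed, so it is separated
      -- by w from one of x and y.
      separated⇒pushBlock : ∀ {x y w} → push S x ≡ push S y →
                            pop S x < push S w → push S w < pop S y → PushBlock S T x
      separated⇒pushBlock {x} {y} {w} eq x<w w<y u with push S w <? pop S u
      ... | yes w<u = sym⇔ (separated⇒samePush x<w w<u)
      ... | no  w≮u = mk⇔ (λ p → trans (to u~y (trans p eq)) (sym eqT))
                          (λ p → trans (from u~y (trans p eqT)) (sym eq))
        where
        u~y = separated⇒samePush (push≮pop⇒pop<push S w≮u) w<y
        eqT = to (separated⇒samePush x<w w<y) eq

      -- Every `u` is pushed before or after `w` is popped, so it is separated by `w` from `y` or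
      -- from `x`.
      separated⇒popBlock : ∀ {x y w} → pop S x ≡ pop S y →
                           push S x < pop S w → pop S w < push S y → PopBlock S T x
      separated⇒popBlock {x} {y} {w} eq x<w w<y u with push S u <? pop S w
      ... | no  u≮w = sym⇔ (separated⇒samePop x<w (push≮pop⇒pop<push S u≮w))
      ... | yes u<w = mk⇔ (λ p → trans (to u~y (trans p eq)) (sym eqT))
                          (λ p → trans (from u~y (trans p eqT)) (sym eq))
        where
        u~y = separated⇒samePop u<w w<y
        eqT = to (separated⇒samePop x<w w<y) eq

-- Positions in lists and prefix sums.

private
  variable
    A B : Set

-- Lookup as a relation indexed by a natural number, so that positions of different sequences live
-- in one type.
data At {A : Set} : List A → ℕ → A → Set where
  here  : ∀ {o xs} → At (o ∷ xs) 0 o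
  there : ∀ {o p xs k} → At xs k o → At (p ∷ xs) (suc k) o

at-lookup : (xs : List A) (i : Fin (length xs)) → At xs (toℕ i) (lookup xs i)
at-lookup (x ∷ xs) zero    = here
at-lookup (x ∷ xs) (suc i) = there (at-lookup xs i)

at-index : ∀ {xs : List A} {k o} → At xs k o → Σ[ i ∈ Fin (length xs) ] toℕ i ≡ k
at-index here = zero , refl
at-index (there p) with i , eq ← at-index p = suc i , cong suc eq

at-functional : ∀ {xs : List A} {k o p} → At xs k o → At xs k p → o ≡ p
at-functional here      here      = refl
at-functional (there a) (there b) = at-functional a b

at-≤ : ∀ {xs : List A} {i j o} → At xs j o → i ≤ j → ∃[ p ] At xs i p
at-≤ a         z≤n with a
... | here    = _ , here
... | there _ = _ , here
at-≤ (there a) (s≤s i≤j) with p , b ← at-≤ a i≤j = p , there b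

at-or-end : (xs : List A) (k : ℕ) → (∃[ o ] At xs k o) ⊎ take (suc k) xs ≡ take k xs
at-or-end []       zero    = inj₂ refl
at-or-end []       (suc k) = inj₂ refl
at-or-end (x ∷ xs) zero    = inj₁ (x , here)
at-or-end (x ∷ xs) (suc k) with at-or-end xs k
... | inj₁ (o , a) = inj₁ (o , there a)
... | inj₂ eq      = inj₂ (cong (x ∷_) eq)

linked-at : ∀ {R : A → A → Set} {xs k o p} → Linked R xs → At xs k o → At xs (suc k) p → R o p
linked-at (r ∷ _) here      (there here) = r
linked-at (_ ∷ l) (there a) (there b)    = linked-at l a b

foldl-take-suc : ∀ (g : B → A → B) {s xs k o} → At xs k o →
                 foldl g s (take (suc k) xs) ≡ g (foldl g s (take k xs)) o
foldl-take-suc g here      = refl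
foldl-take-suc g (there a) = foldl-take-suc g a

module _ (f : A → ℕ) where

  prefixSum : List A → ℕ → ℕ
  prefixSum xs k = sum (map f (take k xs))

  prefixSum-suc : ∀ {xs k o} → At xs k o → prefixSum xs (suc k) ≡ prefixSum xs k + f o
  prefixSum-suc here = +-identityʳ _
  prefixSum-suc (there {p = p} a) = trans (cong (f p +_) (prefixSum-suc a)) (sym (+-assoc (f p) _ _))

  prefixSum-mono : ∀ xs {i j} → i ≤ j → prefixSum xs i ≤ prefixSum xs j
  prefixSum-mono xs       z≤n       = z≤n
  prefixSum-mono []       (s≤s _)   = z≤n
  prefixSum-mono (x ∷ xs) (s≤s i≤j) = +-monoʳ-≤ (f x) (prefixSum-mono xs i≤j)

  prefixSum≤sum : ∀ xs k → prefixSum xs k ≤ sum (map f xs)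
  prefixSum≤sum xs       zero    = z≤n
  prefixSum≤sum []       (suc k) = z≤n
  prefixSum≤sum (x ∷ xs) (suc k) = +-monoʳ-≤ (f x) (prefixSum≤sum xs k)

  -- The position k with prefixSum xs k < x ≤ prefixSum xs (suc k), for 0 < x ≤ sum (map f xs).
  locate : List A → ℕ → ℕ
  locate []       x = 0
  locate (o ∷ xs) x with x ≤? f o
  ... | yes _ = 0
  ... | no  _ = suc (locate xs (x ∸ f o))

  -- With the converse that follows, this makes `locate` adjoint to `prefixSum`; the properties of
  -- blocks below come from this pair.
  locate<⇒≤ : ∀ xs {x i} → x ≤ sum (map f xs) → locate xs x < i → x ≤ prefixSum xs i
  locate<⇒≤ [] x≤ (s≤s _) = x≤
  locate<⇒≤ (o ∷ xs) {x} x≤ lt with x ≤? f o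
  locate<⇒≤ (o ∷ xs) {x} x≤ (s≤s _)  | yes p = ≤-trans p (m≤m+n _ _)
  locate<⇒≤ (o ∷ xs) {x} x≤ (s≤s lt) | no _  =
    ≤-trans (m≤n+m∸n x (f o)) (+-monoʳ-≤ (f o) (locate<⇒≤ xs (m≤n+o⇒m∸n≤o x (f o) x≤) lt))

  ≤⇒locate< : ∀ xs {x i} → 0 < x → x ≤ prefixSum xs i → locate xs x < i
  ≤⇒locate< xs       {i = zero}  0<x x≤ = contradiction 0<x (≤⇒≯ x≤)
  ≤⇒locate< []       {i = suc i} 0<x x≤ = contradiction 0<x (≤⇒≯ x≤)
  ≤⇒locate< (o ∷ xs) {x} {suc i} 0<x x≤ with x ≤? f o
  ... | yes _ = z<s
  ... | no  p = s≤s (≤⇒locate< xs (m<n⇒0<n∸m (≰⇒> p)) (m≤n+o⇒m∸n≤o x (f o) x≤))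

  -- Positivity of `f o` reveals the kind of operation: `pushSize` is positive only on pushes and
  -- `popSize` only on pops.
  locate-at : ∀ xs {x} → 0 < x → x ≤ sum (map f xs) → ∃[ o ] (At xs (locate xs x) o × 0 < f o)
  locate-at []       0<x x≤ = contradiction 0<x (≤⇒≯ x≤)
  locate-at (o ∷ xs) {x} 0<x x≤ with x ≤? f o
  ... | yes p = o , here , ≤-trans 0<x p
  ... | no  p with o′ , a , q ← locate-at xs (m<n⇒0<n∸m (≰⇒> p)) (m≤n+o⇒m∸n≤o x (f o) x≤)
      = o′ , there a , q

  module _ (xs : List A) {x : ℕ} (0<x : 0 < x) (x≤ : x ≤ sum (map f xs)) where

    locate≡⇒bounds : ∀ {k} → locate xs x ≡ k → prefixSum xs k < x × x ≤ prefixSum xs (suc k)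
    locate≡⇒bounds refl = ≰⇒> (λ p → <-irrefl refl (≤⇒locate< xs 0<x p)) , locate<⇒≤ xs x≤ ≤-refl

    bounds⇒locate≡ : ∀ {k} → prefixSum xs k < x → x ≤ prefixSum xs (suc k) → locate xs x ≡ k
    bounds⇒locate≡ p q = ≤-antisym (≤-pred (≤⇒locate< xs 0<x q))
                                   (≮⇒≥ λ r → <⇒≱ p (locate<⇒≤ xs x≤ r))

    locate-mono : ∀ {y} → y ≤ sum (map f xs) → x ≤ y → locate xs x ≤ locate xs y
    locate-mono y≤ x≤y = ≤-pred (≤⇒locate< xs 0<x (≤-trans x≤y (locate<⇒≤ xs y≤ ≤-refl)))

-- Ranges of consecutive numbers and block moves.

range : ℕ → ℕ → List ℕ
range p zero    = []
range p (suc m) = suc p ∷ range (suc p) m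

applyUpTo≡range : ∀ {f : ℕ → ℕ} p n → (∀ x → f x ≡ suc (p + x)) → applyUpTo f n ≡ range p n
applyUpTo≡range p zero    eq = refl
applyUpTo≡range p (suc n) eq = cong₂ _∷_ (trans (eq 0) (cong suc (+-identityʳ p)))
  (applyUpTo≡range (suc p) n λ x → trans (eq (suc x)) (cong suc (+-suc p x)))

take-range : ∀ p a {m} → take a (range p (a + m)) ≡ range p a
take-range p zero    = refl
take-range p (suc a) = cong (suc p ∷_) (take-range (suc p) a)

drop-range : ∀ p a {m} → drop a (range p (a + m)) ≡ range (p + a) m
drop-range p zero    {m} = cong (λ q → range q m) (sym (+-identityʳ p))
drop-range p (suc a) {m} = trans (drop-range (suc p) a) (cong (λ q → range q m) (sym (+-suc p a)))

length-range : ∀ p m → length (range p m) ≡ m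
length-range p zero    = refl
length-range p (suc m) = cong suc (length-range (suc p) m)

∈-range⁺ : ∀ p m {x} → p < x → x ≤ p + m → x ∈ range p m
∈-range⁺ p zero    p<x x≤ = contradiction p<x (≤⇒≯ (≤-trans x≤ (≤-reflexive (+-identityʳ p))))
∈-range⁺ p (suc m) p<x x≤ with m≤n⇒m<n∨m≡n p<x
... | inj₁ lt   = there (∈-range⁺ (suc p) m lt (≤-trans x≤ (≤-reflexive (+-suc p m))))
... | inj₂ refl = here refl

range-all : ∀ p m → All (λ x → p < x × x ≤ p + m) (range p m)
range-all p zero    = []
range-all p (suc m) =
  (≤-refl , ≤-trans (s≤s (m≤m+n p m)) (≤-reflexive (sym (+-suc p m)))) ∷
  All.map (λ (q , r) → <⇒≤ q , ≤-trans r (≤-reflexive (sym (+-suc p m)))) (range-all (suc p) m)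

∈-range⁻ : ∀ p m {x} → x ∈ range p m → p < x × x ≤ p + m
∈-range⁻ p m = All.lookup (range-all p m)

range-allPairs : ∀ {R : ℕ → ℕ → Set} p m → (∀ {x y} → p < x → x < y → y ≤ p + m → R x y) →
                 AllPairs R (range p m)
range-allPairs p zero    r = []
range-allPairs p (suc m) r =
  All.map (λ (q , s) → r ≤-refl q (≤-trans s (≤-reflexive (sym (+-suc p m))))) (range-all (suc p) m)
  ∷ range-allPairs (suc p) m (λ q lt s → r (<⇒≤ q) lt (≤-trans s (≤-reflexive (sym (+-suc p m)))))

-- Moving a block to the next stack swaps two adjacent segments of the concatenated stacks; this
-- serves pushes and pops alike.
drop-take-↭ : ∀ k (xs zs : List A) → drop k xs ++ take k xs ++ zs ↭ xs ++ zs
drop-take-↭ k xs zs = ↭-trans (shifts (drop k xs) (take k xs))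
  (↭-reflexive (trans (sym (++-assoc (take k xs) _ _)) (cong (_++ zs) (take++drop≡id k xs))))

allPairs-split : ∀ {R : A → A → Set} b {xs x y} → AllPairs R xs → x ∈ take b xs → y ∈ drop b xs → R x y
allPairs-split (suc b) (r ∷ _) (here refl) y∈ = All.lookup r (drop-⊆ b y∈)
  where
  drop-⊆ : ∀ b {xs : List A} {y} → y ∈ drop b xs → y ∈ xs
  drop-⊆ zero    y∈ = y∈
  drop-⊆ (suc b) {_ ∷ _} y∈ = there (drop-⊆ b y∈)
allPairs-split (suc b) (_ ∷ rs) (there x∈) y∈ = allPairs-split b rs x∈ y∈

-- Ranks in a stack.

-- Ranks are counted from 1 at the end of the list, the bottom of the stack.
data Rank {A : Set} : List A → A → ℕ → Set where
  here  : ∀ {x xs} → Rank (x ∷ xs) x (suc (length xs))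
  there : ∀ {x y xs r} → Rank xs x r → Rank (y ∷ xs) x r

module _ {A : Set} where

  rank-bounds : ∀ {xs : List A} {x r} → Rank xs x r → 0 < r × r ≤ length xs
  rank-bounds here      = z<s , ≤-refl
  rank-bounds (there p) with 0<r , r≤ ← rank-bounds p = 0<r , m≤n⇒m≤1+n r≤

  rank⇒∈ : ∀ {xs : List A} {x r} → Rank xs x r → x ∈ xs
  rank⇒∈ here      = here refl
  rank⇒∈ (there p) = there (rank⇒∈ p)

  rank-functional : ∀ {xs : List A} {x y r} → Rank xs x r → Rank xs y r → x ≡ y
  rank-functional here      here      = refl
  rank-functional here      (there q) = contradiction ≤-refl (<⇒≱ (s≤s (proj₂ (rank-bounds q))))
  rank-functional (there p) here      = contradiction ≤-refl (<⇒≱ (s≤s (proj₂ (rank-bounds p))))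
  rank-functional (there p) (there q) = rank-functional p q

  rank-unique : ∀ {xs : List A} {x r s} → Unique xs → Rank xs x r → Rank xs x s → r ≡ s
  rank-unique (_ ∷ _)  here      here      = refl
  rank-unique (x∉ ∷ _)  here      (there q) = contradiction refl (All.lookup x∉ (rank⇒∈ q))
  rank-unique (x∉ ∷ _)  (there p) here      = contradiction refl (All.lookup x∉ (rank⇒∈ p))
  rank-unique (_ ∷ xs) (there p) (there q) = rank-unique xs p q

  ∈⇒rank : ∀ {xs : List A} {x} → x ∈ xs → ∃[ r ] Rank xs x r
  ∈⇒rank (here refl) = _ , here
  ∈⇒rank (there p) with r , q ← ∈⇒rank p = r , there q

  rank-surjective : ∀ (xs : List A) {r} → 0 < r → r ≤ length xs → ∃[ x ] Rank xs x r
  rank-surjective []       0<r r≤ = contradiction 0<r (≤⇒≯ r≤)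
  rank-surjective (x ∷ xs) 0<r r≤ with m≤n⇒m<n∨m≡n r≤
  ... | inj₁ (s≤s r≤′) with y , p ← rank-surjective xs 0<r r≤′ = y , there p
  ... | inj₂ refl = x , here

  -- Counting from the bottom keeps a rank unchanged when elements are placed on top.
  rank-++⁺ʳ : ∀ (xs : List A) {ys x r} → Rank ys x r → Rank (xs ++ ys) x r
  rank-++⁺ʳ []       p = p
  rank-++⁺ʳ (x ∷ xs) p = there (rank-++⁺ʳ xs p)

  rank-++⁻ʳ : ∀ (xs : List A) {ys x r} → Rank (xs ++ ys) x r → r ≤ length ys → Rank ys x r
  rank-++⁻ʳ []       p         r≤ = p
  rank-++⁻ʳ (x ∷ xs) {ys} here r≤ = contradiction r≤ (<⇒≱ (s≤s
    (subst (length ys ≤_) (sym (length-++ xs)) (m≤n+m _ (length xs)))))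
  rank-++⁻ʳ (x ∷ xs) (there p) r≤ = rank-++⁻ʳ xs p r≤

  rank-++⁺ˡ : ∀ {xs : List A} ys {x} → x ∈ xs → ∃[ r ] (Rank (xs ++ ys) x r × length ys < r)
  rank-++⁺ˡ {x ∷ xs} ys (here refl) =
    _ , here , s≤s (subst (length ys ≤_) (sym (length-++ xs)) (m≤n+m _ (length xs)))
  rank-++⁺ˡ ys (there x∈) with r , p , lt ← rank-++⁺ˡ ys x∈ = r , there p , lt

  rank-++⁻ˡ : ∀ (xs : List A) {ys x r} → Rank (xs ++ ys) x r → length ys < r → x ∈ xs
  rank-++⁻ˡ []       p         lt = contradiction lt (≤⇒≯ (proj₂ (rank-bounds p)))
  rank-++⁻ˡ (x ∷ xs) here      lt = here refl
  rank-++⁻ˡ (x ∷ xs) (there p) lt = there (rank-++⁻ˡ xs p lt)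

  -- Ranks above `length ys` fall in `xs`, and the larger rank is nearer to the head.
  rank-allPairs : ∀ {R : A → A → Set} {xs ys x y r s} → AllPairs R xs →
                  Rank (xs ++ ys) x r → Rank (xs ++ ys) y s → s < r → length ys < s → R x y
  rank-allPairs [] p q s<r lt = contradiction lt (≤⇒≯ (proj₂ (rank-bounds q)))
  rank-allPairs (_ ∷ _)  here      here      s<r lt = contradiction s<r (<-irrefl refl)
  rank-allPairs {xs = _ ∷ xs} (r ∷ _)  here (there q) s<r lt = All.lookup r (rank-++⁻ˡ xs q lt)
  rank-allPairs (_ ∷ _)  (there p) here      s<r lt =
    contradiction s<r (≤⇒≯ (m≤n⇒m≤1+n (proj₂ (rank-bounds p))))
  rank-allPairs (_ ∷ rs) (there p) (there q) s<r lt = rank-allPairs rs p q s<r lt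

-- Execution of a reduced sequence.

output-suffix : ∀ γ s → ∃[ os ] output (foldl step s γ) ≡ os ++ output s
output-suffix []      s = [] , refl
output-suffix (σ[ a ] ∷ γ) s = output-suffix γ (step s σ[ a ])
output-suffix (τ[ b ] ∷ γ) s with os , eq ← output-suffix γ (step s τ[ b ]) =
  os ++ take b (working s) , trans eq (sym (++-assoc os _ _))

-- Indexed by the permutation and not by a sequence, so that the schedules of equivalent sequences
-- have the same elements.
record Token (π : List ℕ) : Set where
  constructor token
  field
    el rk  : ℕ
    ranked : Rank π el rk

open Token

module Run {π : List ℕ} (α : List Op) (reduced : Reduced α) (π≡ : permutation α ≡ π) where

  open Reduced reduced using (wellFormed; pushPop)
  open WellFormed wellFormed using (prefixes; balanced)

  n : ℕ
  n = size α

  P Q : ℕ → ℕ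
  P = prefixSum pushSize α
  Q = prefixSum popSize α

  pushAt popAt : ℕ → ℕ
  pushAt = locate pushSize α
  popAt  = locate popSize α

  P≤n : ∀ k → P k ≤ n
  P≤n = prefixSum≤sum pushSize α

  stateAfter-suc : ∀ {k o} → At α k o → stateAfter α (suc k) ≡ step (stateAfter α k) o
  stateAfter-suc = foldl-take-suc step

  -- `p` and `q` are the totals pushed and popped, kept as parameters so that a step changes them by
  -- addition; `remaining` is the difference of `n` and `p` without truncated subtraction.
  record Invariant (p q : ℕ) (s : State) : Set where
    field
      remaining : ℕ
      total     : p + remaining ≡ n
      inputs    : input s ≡ range p remaining
      outputs   : length (output s) ≡ q
      workings  : length (working s) + q ≡ p
      bounded   : All (λ x → 0 < x × x ≤ p) (working s)
      ordered   : AllPairs (Above id pushAt) (working s)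
      permuted  : input s ++ working s ++ output s ↭ range 0 n

  open Invariant

  module _ {k a s} .{{_ : NonZero a}} (at : At α k σ[ a ]) (inv : Invariant (P k) (Q k) s) where

    push-fits : ∃[ m ] a + m ≡ remaining inv
    push-fits = m≤n⇒∃[o]m+o≡n (+-cancelˡ-≤ (P k) a _
      (subst₂ _≤_ (prefixSum-suc pushSize at) (sym (total inv)) (P≤n (suc k))))

    take-input : take a (input s) ≡ range (P k) a
    take-input = trans (cong (take a) (trans (inputs inv) (cong (range (P k)) (sym (proj₂ push-fits)))))
                       (take-range (P k) a)

    drop-input : drop a (input s) ≡ range (P k + a) (proj₁ push-fits)
    drop-input = trans (cong (drop a) (trans (inputs inv) (cong (range (P k)) (sym (proj₂ push-fits)))))
                       (drop-range (P k) a)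

  pushAt≡ : ∀ {k a x} .{{_ : NonZero a}} → At α k σ[ a ] → P k < x → x ≤ P k + a → pushAt x ≡ k
  pushAt≡ {k} {x = x} at l u with u′ ← subst (x ≤_) (sym (prefixSum-suc pushSize at)) u =
    bounds⇒locate≡ pushSize α (≤-trans (s≤s z≤n) l) (≤-trans u′ (P≤n (suc k))) l u′

  invariant-step : ∀ {k o s} → At α k o → Invariant (P k) (Q k) s →
                   Invariant (P k + pushSize o) (Q k + popSize o) (step s o)
  invariant-step {k} {σ[ a ]} {⟨ is , ws , os ⟩} at inv = record
      { remaining = proj₁ (push-fits at inv)
      ; total     = trans (+-assoc (P k) a _) (trans (cong (P k +_) (proj₂ (push-fits at inv))) (total inv))
      ; inputs    = drop-input at inv
      ; outputs   = trans (outputs inv) (sym (+-identityʳ (Q k)))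
      ; workings  = lengths
      ; bounded   = All.++⁺
          (subst (All _) (sym block) (All.map (λ (l , u) → ≤-trans (s≤s z≤n) l , u) (range-all (P k) a)))
          (All.map (λ (l , u) → l , ≤-trans u (m≤m+n (P k) a)) (bounded inv))
      -- Inside the new block the push is shared and values increase downwards; the elements below
      -- it were pushed earlier.
      ; ordered   = AllPairs.++⁺
          (subst (AllPairs _) (sym block) (range-allPairs (P k) a λ l lt u →
            inj₂ (trans (pushAt≡ at l (≤-trans (<⇒≤ lt) u)) (sym (pushAt≡ at (<-trans l lt) u)) , lt)))
          (ordered inv)
          (subst (All _) (sym block) (All.map (λ (l , u) → All.map (λ (l′ , u′) →
            inj₁ (≤-trans (≤⇒locate< pushSize α l′ u′) (≤-reflexive (sym (pushAt≡ at l u)))))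
            (bounded inv)) (range-all (P k) a)))
      ; permuted  = ↭-trans
          (↭-trans (↭-reflexive (cong (drop a is ++_) (++-assoc (take a is) ws os)))
                   (drop-take-↭ a is (ws ++ os)))
          (permuted inv)
      }
    where
    open ≡-Reasoning
    block : take a is ≡ range (P k) a
    block = take-input at inv
    lengths : length (take a is ++ ws) + (Q k + 0) ≡ P k + a
    lengths = begin
      length (take a is ++ ws) + (Q k + 0)      ≡⟨ cong₂ _+_ (length-++ (take a is)) (+-identityʳ (Q k)) ⟩
      length (take a is) + length ws + Q k      ≡⟨ cong (λ l → length l + length ws + Q k) block ⟩
      length (range (P k) a) + length ws + Q k  ≡⟨ cong (λ l → l + length ws + Q k) (length-range (P k) a) ⟩
      a + length ws + Q k                       ≡⟨ +-assoc a _ _ ⟩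
      a + (length ws + Q k)                     ≡⟨ cong (a +_) (workings inv) ⟩
      a + P k                                   ≡⟨ +-comm a (P k) ⟩
      P k + a                                   ∎
  invariant-step {k} {τ[ b ]} {⟨ is , ws , os ⟩} at inv = record
      { remaining = remaining inv
      ; total     = trans (cong (_+ remaining inv) (+-identityʳ (P k))) (total inv)
      ; inputs    = trans (inputs inv) (cong (λ p → range p (remaining inv)) (sym (+-identityʳ (P k))))
      ; outputs   = out
      ; workings  = trans work (sym (+-identityʳ (P k)))
      ; bounded   = All.drop⁺ b (subst (λ p → All (λ x → 0 < x × x ≤ p) ws) (sym (+-identityʳ (P k))) (bounded inv))
      ; ordered   = AllPairs.drop⁺ b (ordered inv)
      ; permuted  = ↭-trans (++⁺ˡ is (drop-take-↭ b ws os)) (permuted inv)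
      }
    where
    open ≡-Reasoning
    -- The prefix condition just after this pop ensures that `take` and `drop` do not truncate.
    b≤ : b ≤ length ws
    b≤ = +-cancelʳ-≤ (Q k) b (length ws) (subst₂ _≤_ (trans (prefixSum-suc popSize at) (+-comm (Q k) b))
      (trans (trans (prefixSum-suc pushSize at) (+-identityʳ (P k))) (sym (workings inv)))
      (prefixes (suc k)))
    out : length (take b ws ++ os) ≡ Q k + b
    out = begin
      length (take b ws ++ os)        ≡⟨ length-++ (take b ws) ⟩
      length (take b ws) + length os  ≡⟨ cong₂ _+_ (trans (length-take b ws) (m≤n⇒m⊓n≡m b≤)) (outputs inv) ⟩
      b + Q k                         ≡⟨ +-comm b (Q k) ⟩
      Q k + b                         ∎
    work : length (drop b ws) + (Q k + b) ≡ P k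
    work = begin
      length (drop b ws) + (Q k + b)  ≡⟨ cong₂ _+_ (length-drop b ws) (+-comm (Q k) b) ⟩
      length ws ∸ b + (b + Q k)       ≡⟨ +-assoc (length ws ∸ b) b (Q k) ⟨
      length ws ∸ b + b + Q k         ≡⟨ cong (_+ Q k) (m∸n+n≡m b≤) ⟩
      length ws + Q k                 ≡⟨ workings inv ⟩
      P k                             ∎

  invariant : ∀ k → Invariant (P k) (Q k) (stateAfter α k)
  invariant zero = record
    { remaining = n
    ; total     = refl
    ; inputs    = initials
    ; outputs   = refl
    ; workings  = refl
    ; bounded   = []
    ; ordered   = []
    ; permuted  = ↭-reflexive (trans (++-identityʳ _) initials)
    }
    where initials = applyUpTo≡range 0 n λ _ → refl
  invariant (suc k) with at-or-end α k
  ... | inj₁ (o , at) rewrite prefixSum-suc pushSize at | prefixSum-suc popSize at | stateAfter-suc at =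
    invariant-step at (invariant k)
  ... | inj₂ end rewrite end = invariant k

  invariant-final : Invariant n n (foldl step (initial n) α)
  invariant-final =
    subst (λ β → Invariant (totalPush β) n (foldl step (initial n) β)) (take-all _ α ≤-refl)
      (subst (λ q → Invariant (P (length α)) q (stateAfter α (length α)))
        (trans (cong totalPop (take-all _ α ≤-refl)) balanced) (invariant (length α)))

  -- The output stack only grows on top, so every element has its final rank from the moment it is
  -- output.
  π-suffix : ∀ k → ∃[ os ] π ≡ os ++ output (stateAfter α k)
  π-suffix k with os , eq ← output-suffix (drop k α) (stateAfter α k) =
    os , trans (trans (sym π≡) (cong (output ∘ foldl step (initial n)) (sym (take++drop≡id k α))))
               (trans (cong output (foldl-++ step (initial n) (take k α) (drop k α))) eq)

  length-π : length π ≡ n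
  length-π = trans (cong length (sym π≡)) (outputs invariant-final)

  -- With everything pushed and popped, the counts empty the other two stacks and `permuted` speaks
  -- of the output alone.
  output-permutes : ∀ {s} → Invariant n n s → output s ↭ range 0 n
  output-permutes {⟨ _ , [] , _ ⟩} inv
    with remaining inv | +-cancelˡ-≡ n _ 0 (trans (total inv) (sym (+-identityʳ n))) | inputs inv | permuted inv
  ... | zero | refl | refl | perm = perm
  output-permutes {⟨ _ , _ ∷ ws , _ ⟩} inv =
    contradiction (sym (workings inv)) (<⇒≢ (s≤s (m≤n+m n (length ws))))

  π-permutes : π ↭ range 0 n
  π-permutes = subst (_↭ range 0 n) π≡ (output-permutes invariant-final)

  π-unique : Unique π
  π-unique = Permutationₛ.Unique-resp-↭ (setoid ℕ) (↭⇒↭ₛ (↭-sym π-permutes))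
    (range-allPairs 0 n λ _ lt _ → <⇒≢ lt)

  ∈π⁻ : ∀ {x} → x ∈ π → 0 < x × x ≤ n
  ∈π⁻ = ∈-range⁻ 0 n ∘ ∈-resp-↭ π-permutes

  ∈π⁺ : ∀ {x} → 0 < x → x ≤ n → x ∈ π
  ∈π⁺ 0<x x≤n = ∈-resp-↭ (↭-sym π-permutes) (∈-range⁺ 0 n 0<x x≤n)

  -- By elimination among the three stacks: the input holds only values above `P k`, the output only
  -- ranks up to `Q k`.
  ∈-working : ∀ k {x r} → Rank π x r → x ≤ P k → Q k < r → x ∈ working (stateAfter α k)
  ∈-working k {x} {r} rank x≤ <r
    with 0<x , x≤n ← ∈π⁻ (rank⇒∈ rank)
    with ∈-++⁻ (input (stateAfter α k)) (∈-resp-↭ (↭-sym (permuted (invariant k))) (∈-range⁺ 0 n 0<x x≤n))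
  ... | inj₁ x∈is = contradiction x≤ (<⇒≱ (proj₁ (∈-range⁻ (P k) _ (subst (x ∈_) (inputs (invariant k)) x∈is))))
  ... | inj₂ x∈ with ∈-++⁻ (working (stateAfter α k)) x∈
  ... | inj₁ x∈ws = x∈ws
  ... | inj₂ x∈os with r′ , rank′ ← ∈⇒rank x∈os with os , eq ← π-suffix k
    with refl ← rank-unique π-unique rank (subst (λ l → Rank l x r′) (sym eq) (rank-++⁺ʳ os rank′)) =
    contradiction (subst (r ≤_) (outputs (invariant k)) (proj₂ (rank-bounds rank′))) (<⇒≱ <r)

  module _ {k b} .{{_ : NonZero b}} (at : At α k τ[ b ]) where

    private
      ws = working (stateAfter α k)
      os = output (stateAfter α k)

    output-suc : output (stateAfter α (suc k)) ≡ take b ws ++ os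
    output-suc = cong output (stateAfter-suc at)

    length-output-suc : length (take b ws ++ os) ≡ Q (suc k)
    length-output-suc = trans (cong length (sym output-suc)) (outputs (invariant (suc k)))

    -- The pop at `k` fills exactly the ranks above `Q k` and up to `Q (suc k)`, which are already
    -- final.
    rank-at-pop⁻ : ∀ {x r} → Rank π x r → popAt r ≡ k → Rank (take b ws ++ os) x r × length os < r
    rank-at-pop⁻ {x} {r} rank refl
      with 0<r , r≤ ← rank-bounds rank
      with os′ , eq ← π-suffix (suc k)
      with lo , hi ← locate≡⇒bounds popSize α 0<r (subst (r ≤_) (trans length-π (sym balanced)) r≤) refl =
        rank-++⁻ʳ os′ (subst (λ l → Rank l x r) (trans eq (cong (os′ ++_) output-suc)) rank)
                      (subst (r ≤_) (sym length-output-suc) hi)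
      , subst (_< r) (sym (outputs (invariant k))) lo

    rank-at-pop⁺ : ∀ {x r} → Rank (take b ws ++ os) x r → length os < r → Rank π x r × popAt r ≡ k
    rank-at-pop⁺ {x} {r} rank lo
      with os′ , eq ← π-suffix (suc k)
      with 0<r , r≤ ← rank-bounds rank
      with hi ← subst (r ≤_) length-output-suc r≤ =
        subst (λ l → Rank l x r) (sym (trans eq (cong (os′ ++_) output-suc))) (rank-++⁺ʳ os′ rank)
      , bounds⇒locate≡ popSize α 0<r (≤-trans hi (prefixSum≤sum popSize α (suc k)))
          (subst (_< r) (outputs (invariant k)) lo) hi

    popped⁻ : ∀ {x r} → Rank π x r → popAt r ≡ k → x ∈ take b ws
    popped⁻ rank eq with rank′ , lo ← rank-at-pop⁻ rank eq = rank-++⁻ˡ (take b ws) rank′ lo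

    popped⁺ : ∀ {x} → x ∈ take b ws → ∃[ r ] (Rank π x r × popAt r ≡ k)
    popped⁺ x∈ with r , rank , lo ← rank-++⁺ˡ os x∈ = r , rank-at-pop⁺ rank lo

  module _ {k a} .{{_ : NonZero a}} (at : At α k σ[ a ]) where

    pushed⁻ : ∀ {x} → 0 < x → x ≤ n → pushAt x ≡ k → x ∈ take a (input (stateAfter α k))
    pushed⁻ {x} 0<x x≤n eq with lo , hi ← locate≡⇒bounds pushSize α 0<x x≤n eq =
      subst (x ∈_) (sym (take-input at (invariant k)))
        (∈-range⁺ (P k) a lo (subst (x ≤_) (prefixSum-suc pushSize at) hi))

    pushed⁺ : ∀ {x} → x ∈ take a (input (stateAfter α k)) → pushAt x ≡ k
    pushed⁺ {x} x∈ with lo , hi ← ∈-range⁻ (P k) a (subst (x ∈_) (take-input at (invariant k)) x∈) =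
      pushAt≡ at lo hi

  el-bounds : (e : Token π) → 0 < el e × el e ≤ n
  el-bounds e = ∈π⁻ (rank⇒∈ (ranked e))

  rk-bounds : (e : Token π) → 0 < rk e × rk e ≤ totalPop α
  rk-bounds e with 0<r , r≤ ← rank-bounds (ranked e) =
    0<r , subst (rk e ≤_) (trans length-π (sym balanced)) r≤

  pushed : (e : Token π) → ∃[ o ] (At α (pushAt (el e)) o × IsPush o)
  pushed e with 0<x , x≤n ← el-bounds e with locate-at pushSize α 0<x x≤n
  ... | σ[ a ] , at , _ = σ[ a ] , at , _

  popped : (e : Token π) → ∃[ o ] (At α (popAt (rk e)) o × IsPop o)
  popped e with 0<r , r≤n ← rk-bounds e with locate-at popSize α 0<r r≤n
  ... | τ[ b ] , at , _ = τ[ b ] , at , _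

  element : ∀ {x} → 0 < x → x ≤ n → Σ[ e ∈ Token π ] el e ≡ x
  element 0<x x≤n with r , rank ← ∈⇒rank (∈π⁺ 0<x x≤n) = token _ r rank , refl

  outcome : ∀ {r} → 0 < r → r ≤ totalPop α → Σ[ e ∈ Token π ] rk e ≡ r
  outcome 0<r r≤ with x , rank ← rank-surjective π 0<r (subst (_ ≤_) (trans balanced (sym length-π)) r≤) =
    token x _ rank , refl

  pushAt≢popAt : (e f : Token π) → pushAt (el e) ≢ popAt (rk f)
  pushAt≢popAt e f eq with pushed e | popped f
  ... | σ[ _ ] , at , _ | τ[ _ ] , at′ , _ with () ← at-functional (subst (λ k → At α k _) eq at) at′

  -- At its pop `e` is on the working stack, where `bounded` limits its value by the total pushed so
  -- far.
  pushAt<popAt : (e : Token π) → pushAt (el e) < popAt (rk e)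
  pushAt<popAt e with popped e
  ... | τ[ b ] , at , _
    with 0<x , x≤ ← All.lookup (All.take⁺ b (bounded (invariant (popAt (rk e))))) (popped⁻ at (ranked e) refl) =
    ≤⇒locate< pushSize α 0<x x≤

  -- Read off from `ordered` at the moment `f` is popped. In a common pop, ranks give the order
  -- within the block; otherwise `f` is in the part taken and `e`, if already pushed, in the part
  -- left.
  stack-law : (e f : Token π) → rk f < rk e →
              (popAt (rk f) < popAt (rk e) ×
                (pushAt (el e) < popAt (rk f) → Above el (pushAt ∘ el) f e)) ⊎
              (popAt (rk e) ≡ popAt (rk f) × Above el (pushAt ∘ el) e f)
  stack-law e f f<e
    with 0<rf , rf≤ ← rk-bounds f | 0<re , re≤ ← rk-bounds e
    with popped f
  ... | τ[ b ] , at , _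
    with m≤n⇒m<n∨m≡n (locate-mono popSize α 0<rf rf≤ re≤ (<⇒≤ f<e))
  ... | inj₂ eq
    with re , _ ← rank-at-pop⁻ at (ranked e) (sym eq) | rf , lo ← rank-at-pop⁻ at (ranked f) refl =
    inj₂ (sym eq , rank-allPairs (AllPairs.take⁺ b (ordered (invariant (popAt (rk f))))) re rf f<e lo)
  ... | inj₁ lt = inj₁ (lt , λ pushed<k →
    let x≤P = ≤-trans (locate<⇒≤ pushSize α (proj₂ (el-bounds e)) pushed<k)
                      (prefixSum-mono pushSize α (n≤1+n (popAt (rk f))))
        Q<r = ≰⇒> λ r≤Q → <⇒≱ lt (≤-pred (≤⇒locate< popSize α 0<re r≤Q))
        -- Presence just after the pop places `e` in the part left behind.
        e∈  = subst (el e ∈_) (cong working (stateAfter-suc at)) (∈-working (suc (popAt (rk f))) (ranked e) x≤P Q<r)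
    in allPairs-split b (ordered (invariant (popAt (rk f)))) (popped⁻ at (ranked f) refl) e∈)

  -- The single element pushed is on top when a single element is popped, so it goes straight to the
  -- output and takes the next rank.
  peak-element : ∀ {k} → At α k σ → At α (suc k) τ →
                 Σ[ g ∈ Token π ] (el g ≡ P (suc k) × rk g ≤ suc (Q (suc k)))
  peak-element {k} at at′ with popped⁺ at′ (subst (P (suc k) ∈_) (sym top) (here refl))
    where
    open ≡-Reasoning
    top : take 1 (working (stateAfter α (suc k))) ≡ P (suc k) ∷ []
    top = begin
      take 1 (working (stateAfter α (suc k)))
        ≡⟨ cong (take 1 ∘ working) (stateAfter-suc at) ⟩
      take 1 (take 1 (input (stateAfter α k)) ++ working (stateAfter α k))
        ≡⟨ cong (λ xs → take 1 (xs ++ working (stateAfter α k))) (take-input at (invariant k)) ⟩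
      suc (P k) ∷ []
        ≡⟨ cong (_∷ []) (trans (+-comm 1 (P k)) (sym (prefixSum-suc pushSize at))) ⟩
      P (suc k) ∷ [] ∎
  ... | r , rank , eq with 0<r , r≤ ← rk-bounds (token _ r rank) =
    token _ r rank , refl , subst (r ≤_) (trans (prefixSum-suc popSize at′) (+-comm _ 1))
                                  (proj₂ (locate≡⇒bounds popSize α 0<r r≤ eq))

  -- The last element z pushed before e is popped: the operation following its push is
  -- a pop, and reducedness makes this push and this pop move z alone.
  peak-before : (e f : Token π) → pushAt (el f) < popAt (rk e) →
                Σ[ g ∈ Token π ] (el f ≤ el g × rk g ≤ rk e)
  peak-before e f f<e = found (locate-at pushSize α 0<z z≤size)
    where
    j = popAt (rk e)
    z = P j
    k = pushAt z
    f≤z : el f ≤ z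
    f≤z = locate<⇒≤ pushSize α (proj₂ (el-bounds f)) f<e
    0<z : 0 < z
    0<z = ≤-trans (proj₁ (el-bounds f)) f≤z
    z≤size : z ≤ n
    z≤size = P≤n j
    k<j : k < j
    k<j = ≤⇒locate< pushSize α 0<z ≤-refl
    P[1+k]≡z : P (suc k) ≡ z
    P[1+k]≡z = ≤-antisym (prefixSum-mono pushSize α k<j) (proj₂ (locate≡⇒bounds pushSize α 0<z z≤size refl))

    -- A push at `suc k` ahead of `j` would raise `P j` above `z`, and the operation at `j` itself
    -- pops `e`.
    nextIsPop : ∀ {o} → At α (suc k) o → IsPop o
    nextIsPop {τ[ _ ]} _ = _
    nextIsPop {σ[ c ]} at with m≤n⇒m<n∨m≡n k<j
    ... | inj₁ lt = contradiction
            (subst₂ _≤_ (trans (prefixSum-suc pushSize at) (cong (_+ c) P[1+k]≡z)) refl (prefixSum-mono pushSize α lt))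
            (<⇒≱ (m<m+n z (>-nonZero⁻¹ c)))
    ... | inj₂ eq with popped e
    ... | τ[ _ ] , at′ , _ with () ← at-functional (subst (λ i → At α i σ[ c ]) eq at) at′

    found : ∃[ o ] (At α k o × 0 < pushSize o) → Σ[ g ∈ Token π ] (el f ≤ el g × rk g ≤ rk e)
    found (σ[ a ] , at , _)
      with o , at′ ← at-≤ (proj₁ (proj₂ (popped e))) k<j
      with refl , refl ← linked-at pushPop at at′ _ (nextIsPop at′)
      with g , el≡ , rk≤ ← peak-element at at′
      with 0<r , r≤ ← rk-bounds e =
        g
      , subst (el f ≤_) (sym (trans el≡ P[1+k]≡z)) f≤z
      -- The pop at `j` yields only ranks above `Q j`, and `Q (suc k)` is at most `Q j`.
      , ≤-trans rk≤ (≤-trans (s≤s (prefixSum-mono popSize α k<j)) (proj₁ (locate≡⇒bounds popSize α 0<r r≤ refl)))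

  schedule : Schedule {Token π} el rk
  schedule = record
    { push      = pushAt ∘ el
    ; pop       = popAt ∘ rk
    ; push<pop  = pushAt<popAt
    ; push≢pop  = pushAt≢popAt
    ; push-mono = λ e f → locate-mono pushSize α (proj₁ (el-bounds e)) (proj₂ (el-bounds e)) (proj₂ (el-bounds f))
    ; pop-mono  = λ e f → locate-mono popSize α (proj₁ (rk-bounds e)) (proj₂ (rk-bounds e)) (proj₂ (rk-bounds f))
    ; law       = stack-law
    ; peak      = peak-before
    }

-- Coordinates of vertices.

foldl-advance : ∀ γ x y → foldl advance (x , y) γ ≡
                (x ℤ.+ (pos (totalPush γ) ℤ.+ pos (totalPop γ)) , y ℤ.+ (pos (totalPush γ) ℤ.- pos (totalPop γ)))
foldl-advance [] x y = cong₂ _,_ (sym (ℤ.+-identityʳ x)) (sym (ℤ.+-identityʳ y))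
foldl-advance (σ[ a ] ∷ γ) x y = trans (foldl-advance γ _ _) (cong₂ _,_
  (sum-eq x (pos a) (pos (totalPush γ)) (pos (totalPop γ))) (diff-eq y (pos a) (pos (totalPush γ)) (pos (totalPop γ))))
  where
  sum-eq : ∀ x a p q → x ℤ.+ a ℤ.+ (p ℤ.+ q) ≡ x ℤ.+ (a ℤ.+ p ℤ.+ q)
  sum-eq = solve-∀
  diff-eq : ∀ y a p q → y ℤ.+ a ℤ.+ (p ℤ.- q) ≡ y ℤ.+ (a ℤ.+ p ℤ.- q)
  diff-eq = solve-∀
foldl-advance (τ[ b ] ∷ γ) x y = trans (foldl-advance γ _ _) (cong₂ _,_
  (sum-eq x (pos b) (pos (totalPush γ)) (pos (totalPop γ))) (diff-eq y (pos b) (pos (totalPush γ)) (pos (totalPop γ))))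
  where
  sum-eq : ∀ x b p q → x ℤ.+ b ℤ.+ (p ℤ.+ q) ≡ x ℤ.+ (p ℤ.+ (b ℤ.+ q))
  sum-eq = solve-∀
  diff-eq : ∀ y b p q → y ℤ.- b ℤ.+ (p ℤ.- q) ≡ y ℤ.+ (p ℤ.- (b ℤ.+ q))
  diff-eq = solve-∀

vertex-totals : ∀ α k → let p = totalPush (take k α); q = totalPop (take k α) in
                vertex α k ≡ (pos p ℤ.+ pos q , pos p ℤ.- pos q)
vertex-totals α k = trans (foldl-advance (take k α) _ _) (cong₂ _,_ (ℤ.+-identityˡ _) (ℤ.+-identityˡ _))

-- Adding the equations doubles `p`. Thus a vertex determines the totals pushed and popped before
-- it.
sum-diff-injective : ∀ {p q p′ q′} → pos p ℤ.+ pos q ≡ pos p′ ℤ.+ pos q′ → pos p ℤ.- pos q ≡ pos p′ ℤ.- pos q′ →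
                     p ≡ p′ × q ≡ q′
sum-diff-injective {p} {q} {p′} {q′} s d =
  p≡p′ , +-cancelˡ-≡ p q q′ (ℤ.+-injective (trans s (cong (λ x → pos x ℤ.+ pos q′) (sym p≡p′))))
  where
  double : ∀ x y → x ℤ.+ y ℤ.+ (x ℤ.- y) ≡ pos 2 ℤ.* x
  double = solve-∀
  p≡p′ : p ≡ p′
  p≡p′ = ℤ.+-injective (ℤ.*-cancelˡ-≡ (pos 2) (pos p) (pos p′)
    (trans (sym (double (pos p) (pos q))) (trans (cong₂ ℤ._+_ s d) (double (pos p′) (pos q′)))))

-- Correspondence through common elements.

module Correspondence {π : List ℕ} (α : List Op) (reduced : Reduced α) (π≡ : permutation α ≡ π) where

  open Run α reduced π≡

  support-push⁺ : ∀ {k o x} → At α k o → IsPush o → x ∈ affected o (stateAfter α k) → pushAt x ≡ k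
  support-push⁺ {o = σ[ _ ]} at _ = pushed⁺ at

  support-pop⁺ : ∀ {k o x} → At α k o → IsPop o → x ∈ affected o (stateAfter α k) →
                 ∃[ r ] (Rank π x r × popAt r ≡ k)
  support-pop⁺ {o = τ[ _ ]} at _ = popped⁺ at

  support-push⁻ : ∀ {o} e → At α (pushAt (el e)) o → IsPush o × el e ∈ affected o (stateAfter α (pushAt (el e)))
  support-push⁻ e at with pushed e
  ... | σ[ _ ] , at′ , _ with refl ← at-functional at at′ =
    _ , pushed⁻ at′ (proj₁ (el-bounds e)) (proj₂ (el-bounds e)) refl

  support-pop⁻ : ∀ {o} e → At α (popAt (rk e)) o → IsPop o × el e ∈ affected o (stateAfter α (popAt (rk e)))
  support-pop⁻ e at with popped e
  ... | τ[ _ ] , at′ , _ with refl ← at-functional at at′ = _ , popped⁻ at′ (ranked e) refl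

  Meets : Token π → ℕ → ℕ → Set
  Meets e i j = pushAt (el e) ≡ i × popAt (rk e) ≡ j

  corresponds⁻ : ∀ {i j} → Corresponds α i j →
                 Σ[ e ∈ Token π ] (Meets e (toℕ i) (toℕ j) ⊎ Meets e (toℕ j) (toℕ i))
  corresponds⁻ {i} {j} record { opposite = inj₁ (i↑ , j↓) ; intersect = x , x∈i , x∈j }
    with r , rank , eq ← support-pop⁺ (at-lookup α j) j↓ x∈j =
    token x r rank , inj₁ (support-push⁺ (at-lookup α i) i↑ x∈i , eq)
  corresponds⁻ {i} {j} record { opposite = inj₂ (i↓ , j↑) ; intersect = x , x∈i , x∈j }
    with r , rank , eq ← support-pop⁺ (at-lookup α i) i↓ x∈i =
    token x r rank , inj₂ (support-push⁺ (at-lookup α j) j↑ x∈j , eq)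

  support-push : ∀ {i} e → pushAt (el e) ≡ toℕ i → IsPush (lookup α i) × el e ∈ support α i
  support-push {i} e eq =
    subst (λ k → At α k (lookup α i) → IsPush (lookup α i) × el e ∈ affected (lookup α i) (stateAfter α k))
      eq (support-push⁻ e) (at-lookup α i)

  support-pop : ∀ {i} e → popAt (rk e) ≡ toℕ i → IsPop (lookup α i) × el e ∈ support α i
  support-pop {i} e eq =
    subst (λ k → At α k (lookup α i) → IsPop (lookup α i) × el e ∈ affected (lookup α i) (stateAfter α k))
      eq (support-pop⁻ e) (at-lookup α i)

  corresponds⁺ : ∀ {i j} e → Meets e (toℕ i) (toℕ j) → Corresponds α i j × Corresponds α j i
  corresponds⁺ e (p , q) with i↑ , x∈i ← support-push e p | j↓ , x∈j ← support-pop e q =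
      record { opposite = inj₁ (i↑ , j↓) ; intersect = el e , x∈i , x∈j }
    , record { opposite = inj₂ (j↓ , i↑) ; intersect = el e , x∈j , x∈i }

  -- Block sizes are positive; the witness has value `suc (P k)` for a push and rank `suc (Q k)` for
  -- a pop.
  supported : ∀ {k o} → At α k o → Σ[ e ∈ Token π ] (pushAt (el e) ≡ k ⊎ popAt (rk e) ≡ k)
  supported {k} {σ[ a ]} at =
    let hi = subst (P k <_) (sym (prefixSum-suc pushSize at)) (m<m+n (P k) (>-nonZero⁻¹ a))
        x≤ = ≤-trans hi (P≤n (suc k))
        e , el≡ = element z<s x≤
    in e , inj₁ (trans (cong pushAt el≡) (bounds⇒locate≡ pushSize α z<s x≤ ≤-refl hi))
  supported {k} {τ[ b ]} at =
    let hi = subst (Q k <_) (sym (prefixSum-suc popSize at)) (m<m+n (Q k) (>-nonZero⁻¹ b))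
        r≤ = ≤-trans hi (prefixSum≤sum popSize α (suc k))
        e , rk≡ = outcome z<s r≤
    in e , inj₂ (trans (cong popAt rk≡) (bounds⇒locate≡ popSize α z<s r≤ ≤-refl hi))

-- Cuts and running totals.

≤-by-elements : ∀ {n p q} → p ≤ n → (∀ {x} → 0 < x → x ≤ n → x ≤ p → x ≤ q) → p ≤ q
≤-by-elements {p = zero}  _   _ = z≤n
≤-by-elements {p = suc _} p≤n h = h z<s p≤n ≤-refl

module _ {π : List ℕ} {α β : List Op} (redα : Reduced α) (redβ : Reduced β)
         (πα : permutation α ≡ π) (πβ : permutation β ≡ π) where

  private
    module A = Run α redα πα
    module B = Run β redβ πβ

  -- Unless the total is zero, it suffices to test the cut on the element of value `A.P i` and on
  -- that of rank `A.Q i`.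
  totals-≤ : ∀ {i j} → Cut A.schedule B.schedule i j → A.P i ≤ B.P j × A.Q i ≤ B.Q j
  totals-≤ {i} {j} c =
      ≤-by-elements (A.P≤n i) (λ 0<x x≤n x≤P → let e , eq = A.element 0<x x≤n in
        subst (_≤ B.P j) eq (locate<⇒≤ pushSize β (proj₂ (B.el-bounds e))
          (to (pushes c e) (≤⇒locate< pushSize α (proj₁ (A.el-bounds e)) (subst (_≤ A.P i) (sym eq) x≤P)))))
    , ≤-by-elements (prefixSum≤sum popSize α i) (λ 0<r r≤n r≤Q → let e , eq = A.outcome 0<r r≤n in
        subst (_≤ B.Q j) eq (locate<⇒≤ popSize β (proj₂ (B.rk-bounds e))
          (to (pops c e) (≤⇒locate< popSize α (proj₁ (A.rk-bounds e)) (subst (_≤ A.Q i) (sym eq) r≤Q)))))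

  totals⇒push< : ∀ {i j} → A.P i ≡ B.P j → ∀ e → A.pushAt (el e) < i → B.pushAt (el e) < j
  totals⇒push< eq e lt = ≤⇒locate< pushSize β (proj₁ (B.el-bounds e))
    (subst (el e ≤_) eq (locate<⇒≤ pushSize α (proj₂ (A.el-bounds e)) lt))

  totals⇒pop< : ∀ {i j} → A.Q i ≡ B.Q j → ∀ e → A.popAt (rk e) < i → B.popAt (rk e) < j
  totals⇒pop< eq e lt = ≤⇒locate< popSize β (proj₁ (B.rk-bounds e))
    (subst (rk e ≤_) eq (locate<⇒≤ popSize α (proj₂ (A.rk-bounds e)) lt))

-- Common vertices and fixed operations.

module _ {π : List ℕ} {α β : List Op} (redα : Reduced α) (redβ : Reduced β)
         (πα : permutation α ≡ π) (πβ : permutation β ≡ π) where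

  private
    module A = Run α redα πα
    module B = Run β redβ πβ
    S = A.schedule
    T = B.schedule

  cut⇒vertex : ∀ {i j} → Cut S T i j → vertex β j ≡ vertex α i
  cut⇒vertex {i} {j} c =
    let p≤ , q≤ = totals-≤ redα redβ πα πβ c
        p≥ , q≥ = totals-≤ redβ redα πβ πα (cut (λ u → ⇔-sym (pushes c u)) (λ u → ⇔-sym (pops c u)))
    in trans (vertex-totals β j) (trans
         (cong₂ (λ p q → pos p ℤ.+ pos q , pos p ℤ.- pos q) (≤-antisym p≥ p≤) (≤-antisym q≥ q≤))
         (sym (vertex-totals α i)))

  vertex⇒cut : ∀ {i j} → vertex β j ≡ vertex α i → Cut S T i j
  vertex⇒cut {i} {j} eq
    with eq′ ← trans (sym (vertex-totals β j)) (trans eq (vertex-totals α i))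
    with p , q ← sum-diff-injective (cong proj₁ eq′) (cong proj₂ eq′) =
    cut (λ u → mk⇔ (totals⇒push< redα redβ πα πβ (sym p) u) (totals⇒push< redβ redα πβ πα p u))
        (λ u → mk⇔ (totals⇒pop< redα redβ πα πβ (sym q) u) (totals⇒pop< redβ redα πβ πα q u))

  -- Fixedness tested against the single sequence `β`.
  FixedIn : ℕ → Set
  FixedIn i = Σ[ j ∈ Position β ] (vertex β (toℕ j) ≡ vertex α i × vertex β (suc (toℕ j)) ≡ vertex α (suc i))

  edge⇒fixedIn : ∀ {i j o} → At β j o → Edge S T i j → FixedIn i
  edge⇒fixedIn at (c , d) with j , refl ← at-index at = j , cut⇒vertex c , cut⇒vertex d

  fixedIn⇒edge : ∀ {i} → FixedIn i → ∃[ j ] Edge S T i j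
  fixedIn⇒edge (j , p , q) = toℕ j , vertex⇒cut p , vertex⇒cut q

  pushBlock⇒fixedIn : ∀ {e} → PushBlock S T e → FixedIn (push S e)
  pushBlock⇒fixedIn {e} same = edge⇒fixedIn (proj₁ (proj₂ (B.pushed e))) (pushBlock⇒edge {S = S} {T} {e} same)

  popBlock⇒fixedIn : ∀ {e} → PopBlock S T e → FixedIn (pop S e)
  popBlock⇒fixedIn {e} same = edge⇒fixedIn (proj₁ (proj₂ (B.popped e))) (popBlock⇒edge {S = S} {T} {e} same)

  fixedIn? : ∀ i → Dec (FixedIn i)
  fixedIn? i = Fin.any? λ j → (vertex β (toℕ j) ≟ᵖ vertex α i) ×-dec (vertex β (suc (toℕ j)) ≟ᵖ vertex α (suc i))
    where _≟ᵖ_ = Product.≡-dec ℤ._≟_ ℤ._≟_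

  private
    rk-determines-el : (e f : Token π) → rk e ≡ rk f → el e ≡ el f
    rk-determines-el (token _ _ p) (token _ _ q) refl = rank-functional p q

  open Correspondence α redα πα

  -- An element `e` common to both operations carries fixedness across: the block of one at `e`
  -- determines the block of the other.
  corresponds-fixedIn : ∀ {i j} → Corresponds α i j → FixedIn (toℕ j) → FixedIn (toℕ i)
  corresponds-fixedIn {i} {j} corr fix with corresponds⁻ corr
  ... | e , inj₁ (p , q) = subst FixedIn p (pushBlock⇒fixedIn {e}
        (popBlock⇒pushBlock rk-determines-el S T {e}
          (edge⇒popBlock {S = S} {T} {e} (proj₂ (fixedIn⇒edge (subst FixedIn (sym q) fix))))))
  ... | e , inj₂ (p , q) = subst FixedIn q (popBlock⇒fixedIn {e}
        (pushBlock⇒popBlock rk-determines-el S T {e}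
          (edge⇒pushBlock {S = S} {T} {e} (proj₂ (fixedIn⇒edge (subst FixedIn (sym p) fix))))))

  push-gap-fixedIn : ∀ {x y w k} → push S x ≡ push S y → pop S x < k → k < pop S y →
                     push S w ≡ k ⊎ (pop S w ≡ k × push S w ≢ push S x) → FixedIn (push S x)
  push-gap-fixedIn {x} {y} {w} eq x<k k<y at-k =
    let x<w , w<y = Schedule.push-separates S {x} {y} {w} eq x<k k<y at-k
    in pushBlock⇒fixedIn {x} (separated⇒pushBlock rk-determines-el S T {x} {y} {w} eq x<w w<y)

  pop-gap-fixedIn : ∀ {x y w k} → pop S x ≡ pop S y → push S x < k → k < push S y →
                    pop S w ≡ k ⊎ (push S w ≡ k × pop S w ≢ pop S x) → FixedIn (pop S x)
  pop-gap-fixedIn {x} {y} {w} eq x<k k<y at-k =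
    let x<w , w<y = Schedule.pop-separates S {x} {y} {w} eq x<k k<y at-k
    in popBlock⇒fixedIn {x} (separated⇒popBlock rk-determines-el S T {x} {y} {w} eq x<w w<y)

  -- Let the operation at `k` move `w`. Either `i` moves `w` too, so that `k` corresponds to `i`, or
  -- `w` separates `x` from `y` and thereby fixes `i`.
  unfixed⇒consecutive : ∀ {i} → ¬ FixedIn (toℕ i) → Consecutive (Corresponds α i)
  unfixed⇒consecutive {i} unfixed {j} {k} {l} j<k k<l cj cl
    with corresponds⁻ cj | corresponds⁻ cl | supported (at-lookup α k)
  -- In the mixed cases `i` would be both a push and a pop.
  ... | x , inj₁ (px , _) | y , inj₂ (_ , qy) | _ = contradiction (trans px (sym qy)) (A.pushAt≢popAt x y)
  ... | x , inj₂ (_ , qx) | y , inj₁ (py , _) | _ = contradiction (trans py (sym qx)) (A.pushAt≢popAt y x)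
  ... | x , inj₁ (px , qx) | y , inj₁ (py , qy) | w , at-k
      with gap ← push-gap-fixedIn {x} {y} {w} {toℕ k} (trans px (sym py))
                   (subst (_< toℕ k) (sym qx) j<k) (subst (toℕ k <_) (sym qy) k<l)
      with at-k
  ... | inj₁ p = contradiction (subst FixedIn px (gap (inj₁ p))) unfixed
  ... | inj₂ q with A.pushAt (el w) ≟ A.pushAt (el x)
  ... | yes eq = proj₁ (corresponds⁺ w (trans eq px , q))
  ... | no neq = contradiction (subst FixedIn px (gap (inj₂ (q , neq)))) unfixed
  unfixed⇒consecutive {i} unfixed {j} {k} {l} j<k k<l cj cl
      | x , inj₂ (px , qx) | y , inj₂ (py , qy) | w , at-k
      with gap ← pop-gap-fixedIn {x} {y} {w} {toℕ k} (trans qx (sym qy))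
                   (subst (_< toℕ k) (sym px) j<k) (subst (toℕ k <_) (sym py) k<l)
      with at-k
  ... | inj₂ q = contradiction (subst FixedIn qx (gap (inj₁ q))) unfixed
  ... | inj₁ p with A.popAt (rk w) ≟ A.popAt (rk x)
  ... | yes eq = proj₂ (corresponds⁺ w (p , trans eq qx))
  ... | no neq = contradiction (subst FixedIn qx (gap (inj₂ (p , neq)))) unfixed

mainTheorem12 : (α : List Op) → Reduced α →
    ((i : Position α) → ¬ Consecutive (Corresponds α i) → Fixed α i)
    × ((i j : Position α) → Corresponds α i j → Fixed α j → Fixed α i)
mainTheorem12 α redα =
    (λ i ¬consecutive β redβ α~β → let π≡ = sym (Equivalent.samePermutation α~β) in
      -- Failure of consecutiveness provides no explicit gap, but fixedness against `β` is
      -- decidable, so refuting its negation suffices.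
      decidable-stable (fixedIn? redα redβ refl π≡ (toℕ i)) λ unfixed →
        ¬consecutive (unfixed⇒consecutive redα redβ refl π≡ unfixed))
  , (λ i j corr fixed β redβ α~β →
      corresponds-fixedIn redα redβ refl (sym (Equivalent.samePermutation α~β)) corr (fixed β redβ α~β))
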